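{- For any integer $\gamma \geq 0$, the group of symmetries of $\mathsf{Dias}_\gamma$ as a set-operad contains two elements: the identity map and the linear map sending any word of $\mathsf{Dias}_\gamma$ to its mirror image.
   Context: Write $[\gamma] = \{1, \dots, \gamma\}$ (empty if $\gamma = 0$). A set-operad is a nonsymmetric operad in sets, described by partial compositions $\circ_i$ and a unit; it gives rise to an operad on the linear span of its elements by extending the partial compositions linearly. $\mathsf{Dias}_\gamma$ is the set-operad generated by the two-letter words $0a$ and $a0$, $a \in [\gamma]$, inside the set-operad $\mathsf{T}\mathcal{M}_\gamma$ whose elements of arity $n \ge 1$ are all words of length $n$ on $\{0\} \cup [\gamma]$, with partial compositions $u \circ_i v := u_1 \dots u_{i-1}\,\max(u_i, v_1) \dots \max(u_i, v_m)\, u_{i+1} \dots u_n$ (for $u$ of length $n$, $v$ of length $m$, $1 \le i \le n$) and unit the word $0$. Its elements are exactly the words on $\{0\} \cup [\gamma]$ with exactly one occurrence of $0$. An operad morphism is a map (linear, in the setting of vector spaces) that respects arities, sends unit to unit, and commutes with partial compositions. An operad antimorphism is a map (linear, in the setting of vector spaces) $\phi$ that respects arities and satisfies $\phi(x \circ_i y) = \phi(x) \circ_{n-i+1} \phi(y)$ for all $x$ of arity $n$, all $y$, and all $1 \le i \le n$. A symmetry of an operad is either an automorphism or an antiautomorphism; here, the operad being considered as a set-operad, symmetries send words to words. The symmetries form a group under composition, called the group of symmetries. The mirror image of $x_1 \dots x_n$ is $x_n \dots x_1$.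
   Formalization: That the identity and the mirror map are two different elements is claimed only for γ ≥ 1; for γ = 0 the only word is 0, so the two maps coincide and the group has one element. That every symmetry is one of the two is proved for all γ ≥ 0. -}

module Defs where

open import Algebra.Bundles using (Group)
import Algebra.Construct.NaturalChoice.Max as Max
open import Data.Fin.Base using (Fin; zero; suc; toℕ; opposite; _<_)
open import Data.Fin.Properties
  using (≤-totalOrder; opposite-involutive; toℕ<n)
open import Data.Irrelevant using ([_])
open import Data.List.Base as List using (List; []; _∷_)
import Data.List.Properties as List
open import Data.Nat.Base as ℕ using (ℕ; zero; suc; z≤n; s≤s; _+_)
open import Data.Nat.Properties using (+-comm; +-assoc; +-identityʳ; +-suc)
open import Data.Product.Base using (Σ; _,_; proj₁; proj₂)
open import Data.Refinement.Base using (Refinement; value; _,_)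
open import Data.Sum.Base using (_⊎_; inj₁; inj₂)
open import Data.Vec.Base as Vec using (Vec; []; _∷_)
import Data.Vec.Properties as Vec
open import Function.Base using (id; _∘_)
open import Function.Definitions using (Bijective)
open import Level using (0ℓ)
open import Relation.Binary.PropositionalEquality

-- Nonsymmetric set-operads without elements of arity 0: Op n is the set of
-- elements of arity 1 + n, and the element i : Fin (suc n) stands for the
-- input number 1 + toℕ i.  Equations whose two sides have only provably equal
-- arities are stated in the total space Σ ℕ Op.

record SetOperad : Set₁ where
  infixl 7 _∘⟨_⟩_
  field
    Op     : ℕ → Set
    unit   : Op 0
    _∘⟨_⟩_ : ∀ {n m} → Op n → Fin (suc n) → Op m → Op (n + m)

  infix 4 _≋_
  _≋_ : ∀ {n m} → Op n → Op m → Set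
  _≋_ {n} {m} x y = _≡_ {A = Σ ℕ Op} (n , x) (m , y)

  field
    unitˡ : ∀ {n} (x : Op n) → unit ∘⟨ zero ⟩ x ≡ x
    unitʳ : ∀ {n} (x : Op n) (i : Fin (suc n)) → x ∘⟨ i ⟩ unit ≋ x
    sequential : ∀ {n m p} (x : Op n) (y : Op m) (z : Op p)
      (i : Fin (suc n)) (j : Fin (suc m)) (k : Fin (suc (n + m))) →
      toℕ k ≡ toℕ i + toℕ j →
      (x ∘⟨ i ⟩ y) ∘⟨ k ⟩ z ≋ x ∘⟨ i ⟩ (y ∘⟨ j ⟩ z)
    parallel : ∀ {n m p} (x : Op n) (y : Op m) (z : Op p)
      (i j : Fin (suc n)) → i < j →
      (i′ : Fin (suc (n + p))) (j′ : Fin (suc (n + m))) →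
      toℕ i′ ≡ toℕ i → toℕ j′ ≡ toℕ j + m →
      (x ∘⟨ j ⟩ z) ∘⟨ i′ ⟩ y ≋ (x ∘⟨ i ⟩ y) ∘⟨ j′ ⟩ z

-- The suboperad generated by a family of elements.  The witness of generation
-- is irrelevant, so that elements are equal as soon as they are equal in the
-- ambient operad.

module _ (O : SetOperad) where
  open SetOperad O

  data Generated (G : ∀ {n} → Op n → Set) : ∀ {n} → Op n → Set where
    generated   : ∀ {n} {x : Op n} → G x → Generated G x
    identity    : Generated G unit
    composition : ∀ {n m} {x : Op n} {y : Op m} →
      Generated G x → (i : Fin (suc n)) → Generated G y →
      Generated G (x ∘⟨ i ⟩ y)

  generatedSuboperad : (G : ∀ {n} → Op n → Set) → SetOperad
  generatedSuboperad G = record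
    { Op         = Sub
    ; unit       = unit , [ identity ]
    ; _∘⟨_⟩_     = λ where
        (x , [ p ]) i (y , [ q ]) → x ∘⟨ i ⟩ y , [ composition p i q ]
    ; unitˡ      = λ x → value-inj (unitˡ (value x))
    ; unitʳ      = λ x i → lift (unitʳ (value x) i)
    ; sequential = λ x y z i j k eq →
        lift (sequential (value x) (value y) (value z) i j k eq)
    ; parallel   = λ x y z i j i<j i′ j′ eq eq′ →
        lift (parallel (value x) (value y) (value z) i j i<j i′ j′ eq eq′)
    }
    where
    Sub : ℕ → Set
    Sub n = Refinement (Op n) (Generated G)

    value-inj : ∀ {n} {x y : Sub n} → value x ≡ value y → x ≡ y
    value-inj refl = refl

    lift : ∀ {n m} {x : Sub n} {y : Sub m} → value x ≋ value y →
           _≡_ {A = Σ ℕ Sub} (n , x) (m , y)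
    lift refl = refl

module _ (O P : SetOperad) where
  private
    module O = SetOperad O
    module P = SetOperad P

  record IsMorphism (φ : ∀ {n} → O.Op n → P.Op n) : Set where
    field
      unit-homo : φ O.unit ≡ P.unit
      ∘-homo    : ∀ {n m} (x : O.Op n) (i : Fin (suc n)) (y : O.Op m) →
                  φ (x O.∘⟨ i ⟩ y) ≡ φ x P.∘⟨ i ⟩ φ y

  -- With the inputs numbered from 0, opposite i = n - i replaces the
  -- n - i + 1 of the usual numbering from 1.
  record IsAntimorphism (φ : ∀ {n} → O.Op n → P.Op n) : Set where
    field
      ∘-anti-homo : ∀ {n m} (x : O.Op n) (i : Fin (suc n)) (y : O.Op m) →
                    φ (x O.∘⟨ i ⟩ y) ≡ φ x P.∘⟨ opposite i ⟩ φ y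

module _ (O : SetOperad) where
  open SetOperad O

  record IsAutomorphism (φ : ∀ {n} → Op n → Op n) : Set where
    field
      isMorphism : IsMorphism O O φ
      bijective  : ∀ n → Bijective _≡_ _≡_ (φ {n})
    open IsMorphism isMorphism public

  record IsAntiautomorphism (φ : ∀ {n} → Op n → Op n) : Set where
    field
      isAntimorphism : IsAntimorphism O O φ
      bijective      : ∀ n → Bijective _≡_ _≡_ (φ {n})
    open IsAntimorphism isAntimorphism public

  IsSymmetry : (∀ {n} → Op n → Op n) → Set
  IsSymmetry φ = IsAutomorphism φ ⊎ IsAntiautomorphism φ

  record Symmetry : Set where
    constructor symmetry
    field
      map        : ∀ {n} → Op n → Op n
      isSymmetry : IsSymmetry map

module SymmetryProperties (O : SetOperad) where
  open SetOperad O

  Map : Set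
  Map = ∀ {n} → Op n → Op n

  AllBijective : Map → Set
  AllBijective φ = ∀ n → Bijective _≡_ _≡_ (φ {n})

  id-bijective : AllBijective id
  id-bijective n = id , λ y → y , id

  ∘-bijective : {φ ψ : Map} → AllBijective φ → AllBijective ψ →
                AllBijective (φ ∘ ψ)
  ∘-bijective {φ} bφ bψ n =
    (λ eq → proj₁ (bψ n) (proj₁ (bφ n) eq)) ,
    λ y → let x , hx = proj₂ (bφ n) y ; w , hw = proj₂ (bψ n) x in
          w , λ { refl → hx (hw refl) }

  module Inverse (φ : Map) (b : AllBijective φ) where
    inv : Map
    inv {n} y = proj₁ (proj₂ (b n) y)

    invʳ : ∀ {n} (y : Op n) → φ (inv y) ≡ y
    invʳ {n} y = proj₂ (proj₂ (b n) y) refl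

    invˡ : ∀ {n} (x : Op n) → inv (φ x) ≡ x
    invˡ {n} x = proj₁ (b n) (invʳ (φ x))

    inv-unique : ∀ {n} {x y : Op n} → φ x ≡ y → inv y ≡ x
    inv-unique {n} {y = y} eq = proj₁ (b n) (trans (invʳ y) (sym eq))

    inv-bijective : AllBijective inv
    inv-bijective n =
      (λ {x} {y} eq → trans (sym (invʳ x)) (trans (cong φ eq) (invʳ y))) ,
      λ x → φ x , λ { refl → invˡ x }

  anti-unit : (φ : Map) → IsAntiautomorphism O φ → φ unit ≡ unit
  anti-unit φ a = begin
    φ unit                      ≡⟨ sym (≋⇒≡ (unitʳ (φ unit) zero)) ⟩
    φ unit ∘⟨ zero ⟩ unit       ≡⟨ cong (φ unit ∘⟨ zero ⟩_) (sym (invʳ unit)) ⟩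
    φ unit ∘⟨ zero ⟩ φ (inv unit)
                                ≡⟨ sym (∘-anti-homo unit zero (inv unit)) ⟩
    φ (unit ∘⟨ zero ⟩ inv unit) ≡⟨ cong φ (unitˡ (inv unit)) ⟩
    φ (inv unit)                ≡⟨ invʳ unit ⟩
    unit                        ∎
    where
    open ≡-Reasoning
    open IsAntiautomorphism a
    open Inverse φ bijective

    ≋⇒≡ : {x y : Op 0} → x ≋ y → x ≡ y
    ≋⇒≡ refl = refl

  id-isSymmetry : IsSymmetry O id
  id-isSymmetry = inj₁ record
    { isMorphism = record { unit-homo = refl ; ∘-homo = λ _ _ _ → refl }
    ; bijective  = id-bijective
    }

  ∘-isSymmetry : {φ ψ : Map} → IsSymmetry O φ → IsSymmetry O ψ →
                 IsSymmetry O (φ ∘ ψ)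
  ∘-isSymmetry {φ} {ψ} (inj₁ a) (inj₁ b) = inj₁ record
    { isMorphism = record
      { unit-homo = trans (cong φ B.unit-homo) A.unit-homo
      ; ∘-homo    = λ x i y →
          trans (cong φ (B.∘-homo x i y)) (A.∘-homo (ψ x) i (ψ y))
      }
    ; bijective = ∘-bijective {φ} {ψ} A.bijective B.bijective
    }
    where
    module A = IsAutomorphism a
    module B = IsAutomorphism b
  ∘-isSymmetry {φ} {ψ} (inj₁ a) (inj₂ b) = inj₂ record
    { isAntimorphism = record
      { ∘-anti-homo = λ x i y → trans (cong φ (B.∘-anti-homo x i y))
                                      (A.∘-homo (ψ x) (opposite i) (ψ y)) }
    ; bijective = ∘-bijective {φ} {ψ} A.bijective B.bijective
    }
    where
    module A = IsAutomorphism a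
    module B = IsAntiautomorphism b
  ∘-isSymmetry {φ} {ψ} (inj₂ a) (inj₁ b) = inj₂ record
    { isAntimorphism = record
      { ∘-anti-homo = λ x i y → trans (cong φ (B.∘-homo x i y))
                                      (A.∘-anti-homo (ψ x) i (ψ y)) }
    ; bijective = ∘-bijective {φ} {ψ} A.bijective B.bijective
    }
    where
    module A = IsAntiautomorphism a
    module B = IsAutomorphism b
  ∘-isSymmetry {φ} {ψ} (inj₂ a) (inj₂ b) = inj₁ record
    { isMorphism = record
      { unit-homo = trans (cong φ (anti-unit ψ b)) (anti-unit φ a)
      ; ∘-homo    = λ x i y → trans (cong φ (B.∘-anti-homo x i y))
          (trans (A.∘-anti-homo (ψ x) (opposite i) (ψ y))
                 (cong (λ k → φ (ψ x) ∘⟨ k ⟩ φ (ψ y)) (opposite-involutive i)))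
      }
    ; bijective = ∘-bijective {φ} {ψ} A.bijective B.bijective
    }
    where
    module A = IsAntiautomorphism a
    module B = IsAntiautomorphism b

  bijectivity : (s : Symmetry O) → AllBijective (Symmetry.map s)
  bijectivity (symmetry _ (inj₁ a)) = IsAutomorphism.bijective a
  bijectivity (symmetry _ (inj₂ a)) = IsAntiautomorphism.bijective a

  inverse : Symmetry O → Symmetry O
  inverse s@(symmetry φ p) = symmetry inv (isSym p)
    where
    open Inverse φ (bijectivity s)

    isSym : IsSymmetry O φ → IsSymmetry O inv
    isSym (inj₁ a) = inj₁ record
      { isMorphism = record
        { unit-homo = inv-unique A.unit-homo
        ; ∘-homo    = λ x i y → inv-unique
            (trans (A.∘-homo (inv x) i (inv y))
                   (cong₂ (_∘⟨ i ⟩_) (invʳ x) (invʳ y)))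
        }
      ; bijective = inv-bijective
      }
      where
      module A = IsAutomorphism a
    isSym (inj₂ a) = inj₂ record
      { isAntimorphism = record
        { ∘-anti-homo = λ x i y → inv-unique
            (trans (A.∘-anti-homo (inv x) (opposite i) (inv y))
            (trans (cong (λ k → φ (inv x) ∘⟨ k ⟩ φ (inv y)) (opposite-involutive i))
                   (cong₂ (_∘⟨ i ⟩_) (invʳ x) (invʳ y)))) }
      ; bijective = inv-bijective
      }
      where
      module A = IsAntiautomorphism a

symmetryGroup : SetOperad → Group 0ℓ 0ℓ
symmetryGroup O = record
  { Carrier = Symmetry O
  ; _≈_     = λ s t → ∀ {n} (x : Op n) → map s x ≡ map t x
  ; _∙_     = λ s t → symmetry (map s ∘ map t)
                               (∘-isSymmetry (isSymmetry s) (isSymmetry t))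
  ; ε       = symmetry id id-isSymmetry
  ; _⁻¹     = inverse
  ; isGroup = record
    { isMonoid = record
      { isSemigroup = record
        { isMagma = record
          { isEquivalence = record
            { refl  = λ _ → refl
            ; sym   = λ e x → sym (e x)
            ; trans = λ e f x → trans (e x) (f x)
            }
          ; ∙-cong = λ {s} {t} {u} {v} e f x →
              trans (cong (map s) (f x)) (e (map v x))
          }
        ; assoc = λ _ _ _ _ → refl
        }
      ; identity = (λ _ _ → refl) , (λ _ _ → refl)
      }
    ; inverse = (λ s x → Inverse.invˡ (map s) (bijectivity s) x)
              , (λ s x → Inverse.invʳ (map s) (bijectivity s) x)
    ; ⁻¹-cong = λ {s} {t} e x → Inverse.inv-unique (map s) (bijectivity s)
        (trans (e (map (inverse t) x))
               (Inverse.invʳ (map t) (bijectivity t) x))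
    }
  }
  where
  open SetOperad O
  open Symmetry
  open SymmetryProperties O

-- The alphabet {0} ∪ [γ].
Letter : ℕ → Set
Letter γ = Fin (suc γ)

module _ {γ : ℕ} where
  open Max (≤-totalOrder (suc γ)) using (_⊔_)

  infixl 7 _⊚⟨_⟩_
  _⊚⟨_⟩_ : ∀ {n m} → Vec (Letter γ) (suc n) → Fin (suc n) →
           Vec (Letter γ) (suc m) → Vec (Letter γ) (suc (n + m))
  _⊚⟨_⟩_ {n} {m} (a ∷ u) zero v =
    Vec.cast (cong suc (+-comm m n)) (Vec.map (a ⊔_) v Vec.++ u)
  _⊚⟨_⟩_ {suc n} (a ∷ u) (suc i) v = a ∷ (u ⊚⟨ i ⟩ v)

module WordProperties (γ : ℕ) where
  open Max (≤-totalOrder (suc γ)) using (_⊔_; ⊔-assoc; ⊔-identityˡ; ⊔-identityʳ)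

  A : Set
  A = Letter γ

  Word : ℕ → Set
  Word n = Vec A (suc n)

  0⊔ : (a : A) → zero ⊔ a ≡ a
  0⊔ = ⊔-identityˡ (λ _ → z≤n)

  ⊔0 : (a : A) → a ⊔ zero ≡ a
  ⊔0 = ⊔-identityʳ (λ _ → z≤n)

  comp : List A → ℕ → List A → List A
  comp []      _       v = []
  comp (a ∷ u) zero    v = List.map (a ⊔_) v List.++ u
  comp (a ∷ u) (suc i) v = a ∷ comp u i v

  toList-⊚ : ∀ {n m} (u : Word n) (i : Fin (suc n)) (v : Word m) →
             Vec.toList (u ⊚⟨ i ⟩ v) ≡ comp (Vec.toList u) (toℕ i) (Vec.toList v)
  toList-⊚ {n} {m} (a ∷ u) zero v =
    trans (Vec.toList-cast (cong suc (+-comm m n)) (Vec.map (a ⊔_) v Vec.++ u))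
    (trans (Vec.toList-++ (Vec.map (a ⊔_) v) u)
           (cong (List._++ Vec.toList u) (Vec.toList-map (a ⊔_) v)))
  toList-⊚ {suc n} (a ∷ u) (suc i) v = cong (a ∷_) (toList-⊚ u i v)

  toList-injective : ∀ {n m} → n ≡ m → (u : Word n) (v : Word m) →
                     Vec.toList u ≡ Vec.toList v →
                     _≡_ {A = Σ ℕ Word} (n , u) (m , v)
  toList-injective {n} refl u v eq = cong (n ,_)
    (trans (sym (Vec.cast-is-id refl u)) (Vec.toList-injective refl u v eq))

  comp-unitˡ : ∀ v → comp (zero ∷ []) 0 v ≡ v
  comp-unitˡ v =
    trans (List.++-identityʳ _) (trans (List.map-cong 0⊔ v) (List.map-id v))

  comp-unitʳ : ∀ u i → comp u i (zero ∷ []) ≡ u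
  comp-unitʳ []      i       = refl
  comp-unitʳ (a ∷ u) zero    = cong (_∷ u) (⊔0 a)
  comp-unitʳ (a ∷ u) (suc i) = cong (a ∷_) (comp-unitʳ u i)

  comp-map : ∀ a u v w j → j ℕ.< List.length v →
    comp (List.map (a ⊔_) v List.++ u) j w ≡ List.map (a ⊔_) (comp v j w) List.++ u
  comp-map a u (b ∷ v) w zero _ = begin
    List.map ((a ⊔ b) ⊔_) w List.++ (List.map (a ⊔_) v List.++ u)
      ≡⟨ cong (List._++ _) (trans (List.map-cong (⊔-assoc a b) w) (List.map-∘ w)) ⟩
    List.map (a ⊔_) (List.map (b ⊔_) w) List.++ (List.map (a ⊔_) v List.++ u)
      ≡⟨ sym (List.++-assoc (List.map (a ⊔_) (List.map (b ⊔_) w)) _ u) ⟩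
    (List.map (a ⊔_) (List.map (b ⊔_) w) List.++ List.map (a ⊔_) v) List.++ u
      ≡⟨ cong (List._++ u) (sym (List.map-++ (a ⊔_) (List.map (b ⊔_) w) v)) ⟩
    List.map (a ⊔_) (List.map (b ⊔_) w List.++ v) List.++ u ∎
    where open ≡-Reasoning
  comp-map a u (b ∷ v) w (suc j) (s≤s j<) = cong (a ⊔ b ∷_) (comp-map a u v w j j<)

  comp-sequential : ∀ u i v j w → j ℕ.< List.length v →
    comp (comp u i v) (i + j) w ≡ comp u i (comp v j w)
  comp-sequential []      i       v j w j< = refl
  comp-sequential (a ∷ u) zero    v j w j< = comp-map a u v w j j<
  comp-sequential (a ∷ u) (suc i) v j w j< = cong (a ∷_) (comp-sequential u i v j w j<)

  comp-++ : ∀ u v k w → comp (u List.++ v) (List.length u + k) w ≡ u List.++ comp v k w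
  comp-++ []      v k w = refl
  comp-++ (a ∷ u) v k w = cong (a ∷_) (comp-++ u v k w)

  comp-parallel : ∀ u i j v w m → List.length v ≡ suc m → i ℕ.< j →
    comp (comp u j w) i v ≡ comp (comp u i v) (j + m) w
  comp-parallel []      i       j       v w m eq i<j = refl
  comp-parallel (a ∷ u) zero    (suc j) v w m eq i<j =
    sym (trans (cong (λ k → comp (v′ List.++ u) k w) index) (comp-++ v′ u j w))
    where
    v′ = List.map (a ⊔_) v
    index : suc j + m ≡ List.length v′ + j
    index = trans (cong suc (+-comm j m))
                  (cong (_+ j) (sym (trans (List.length-map (a ⊔_) v) eq)))
  comp-parallel (a ∷ u) (suc i) (suc j) v w m eq (s≤s i<j) =
    cong (a ∷_) (comp-parallel u i j v w m eq i<j)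

  length-toList : ∀ {n} (u : Vec A n) → List.length (Vec.toList u) ≡ n
  length-toList []      = refl
  length-toList (a ∷ u) = cong suc (length-toList u)

TM : ℕ → SetOperad
TM γ = record
  { Op         = Word
  ; unit       = zero ∷ []
  ; _∘⟨_⟩_     = _⊚⟨_⟩_
  ; unitˡ      = λ v → homogeneous (toList-injective refl _ v
      (trans (toList-⊚ (zero ∷ []) zero v) (comp-unitˡ (Vec.toList v))))
  ; unitʳ      = λ {n} u i → toList-injective (+-identityʳ n) _ u
      (trans (toList-⊚ u i (zero ∷ [])) (comp-unitʳ (Vec.toList u) (toℕ i)))
  ; sequential = λ {n} {m} {p} u v w i j k eq →
      toList-injective (+-assoc n m p) _ _ (begin
        Vec.toList ((u ⊚⟨ i ⟩ v) ⊚⟨ k ⟩ w)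
          ≡⟨ toList-⊚ (u ⊚⟨ i ⟩ v) k w ⟩
        comp (Vec.toList (u ⊚⟨ i ⟩ v)) (toℕ k) (Vec.toList w)
          ≡⟨ cong₂ (λ x l → comp x l (Vec.toList w)) (toList-⊚ u i v) eq ⟩
        comp (comp (Vec.toList u) (toℕ i) (Vec.toList v)) (toℕ i + toℕ j) (Vec.toList w)
          ≡⟨ comp-sequential (Vec.toList u) (toℕ i) (Vec.toList v) (toℕ j) (Vec.toList w)
               (subst (toℕ j ℕ.<_) (sym (length-toList v)) (toℕ<n j)) ⟩
        comp (Vec.toList u) (toℕ i) (comp (Vec.toList v) (toℕ j) (Vec.toList w))
          ≡⟨ cong (comp (Vec.toList u) (toℕ i)) (toList-⊚ v j w) ⟨
        comp (Vec.toList u) (toℕ i) (Vec.toList (v ⊚⟨ j ⟩ w))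
          ≡⟨ toList-⊚ u i (v ⊚⟨ j ⟩ w) ⟨
        Vec.toList (u ⊚⟨ i ⟩ (v ⊚⟨ j ⟩ w)) ∎)
  ; parallel   = λ {n} {m} {p} u v w i j i<j i′ j′ eq eq′ →
      toList-injective (swap n m p) _ _ (begin
        Vec.toList ((u ⊚⟨ j ⟩ w) ⊚⟨ i′ ⟩ v)
          ≡⟨ toList-⊚ (u ⊚⟨ j ⟩ w) i′ v ⟩
        comp (Vec.toList (u ⊚⟨ j ⟩ w)) (toℕ i′) (Vec.toList v)
          ≡⟨ cong₂ (λ x l → comp x l (Vec.toList v)) (toList-⊚ u j w) eq ⟩
        comp (comp (Vec.toList u) (toℕ j) (Vec.toList w)) (toℕ i) (Vec.toList v)
          ≡⟨ comp-parallel (Vec.toList u) (toℕ i) (toℕ j) (Vec.toList v) (Vec.toList w) m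
               (length-toList v) i<j ⟩
        comp (comp (Vec.toList u) (toℕ i) (Vec.toList v)) (toℕ j + m) (Vec.toList w)
          ≡⟨ cong₂ (λ x l → comp x l (Vec.toList w)) (toList-⊚ u i v) eq′ ⟨
        comp (Vec.toList (u ⊚⟨ i ⟩ v)) (toℕ j′) (Vec.toList w)
          ≡⟨ toList-⊚ (u ⊚⟨ i ⟩ v) j′ w ⟨
        Vec.toList ((u ⊚⟨ i ⟩ v) ⊚⟨ j′ ⟩ w) ∎)
  }
  where
  open WordProperties γ
  open ≡-Reasoning

  homogeneous : ∀ {n} {u v : Word n} → _≡_ {A = Σ ℕ Word} (n , u) (n , v) → u ≡ v
  homogeneous refl = refl

  swap : ∀ n m p → n + p + m ≡ n + m + p
  swap n m p = trans (+-assoc n p m)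
    (trans (cong (n +_) (+-comm p m)) (sym (+-assoc n m p)))

-- The generators 0a and a0; since suc embeds Fin γ in Letter γ, the letters of
-- [γ] are exactly those of the form suc a.
data DiasGenerator (γ : ℕ) : ∀ {n} → SetOperad.Op (TM γ) n → Set where
  0a : (a : Fin γ) → DiasGenerator γ (zero ∷ suc a ∷ [])
  a0 : (a : Fin γ) → DiasGenerator γ (suc a ∷ zero ∷ [])

Dias : ℕ → SetOperad
Dias γ = generatedSuboperad (TM γ) (DiasGenerator γ)

word : ∀ {γ n} → SetOperad.Op (Dias γ) n → Vec (Letter γ) (suc n)
word = value

{-# OPTIONS --safe #-}

-- In arity 2 the elements are the words 0a and a0.  An automorphism φ cannot
-- send 0a to some b0: as 0a ∘₂ 0a = 0aa = 0a ∘₂ a0 and ∘₂ is left cancellative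
-- at b0, it would identify 0a and a0.  Hence φ(0a) = 0π(a), and π preserves the
-- order, because 0a ∘₂ 0b = 0a ∘₂ 0a exactly when b ≤ a.  An injective
-- order-preserving endomap of a finite chain is the identity, so φ fixes every
-- 0a; conjugating by the mirror image, it fixes every a0 as well, and thus all
-- that these words generate.  An antiautomorphism becomes an automorphism after
-- composition with the mirror image.

module Submission where

open import Defs
open import Algebra.Bundles using (Group)
import Algebra.Construct.NaturalChoice.Max as Max
open import Data.Fin.Base as Fin using (Fin; zero; suc; toℕ; opposite; inject₁)
open import Data.Fin.Induction using (<-weakInduction; >-weakInduction)
import Data.Fin.Properties as Fin
open import Data.Irrelevant using ([_])
open import Data.List.Base as List using (List; []; _∷_; length)
import Data.List.Properties as List
open import Data.Nat.Base as ℕ using (ℕ; zero; suc; _≤_; z≤n; s≤s; _+_)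
import Data.Nat.Properties as ℕ
open import Data.Product.Base using (Σ-syntax; _×_; _,_; ∃; proj₁; proj₂)
open import Data.Refinement.Base using (value; _,_)
open import Data.Sum using (_⊎_; inj₁; inj₂; from-inj₁)
open import Data.Vec.Base as Vec using (reverse; []; _∷_)
import Data.Vec.Properties as Vec
open import Function.Base using (_∘_)
open import Relation.Binary.PropositionalEquality
open import Relation.Nullary.Decidable using (recompute)
open import Relation.Nullary.Negation using (¬_; contradiction)

-- Order-preserving self-maps of a finite chain.

-- Each step up the chain raises the value by at least one. Induction from the bottom then gives
-- `i ≤ f i`, and induction from the top gives `f i ≤ i`.
strictMono⇒id : ∀ {n} (f : Fin n → Fin n) → (∀ {i j} → i Fin.< j → f i Fin.< f j) →
                ∀ i → f i ≡ i
strictMono⇒id {suc n} f strict i = Fin.≤-antisym (deflationary i) (inflationary i)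
  where
  inject₁<suc : ∀ (i : Fin n) → inject₁ i Fin.< suc i
  inject₁<suc i = s≤s (ℕ.≤-reflexive (Fin.toℕ-inject₁ i))

  inflationary : ∀ i → i Fin.≤ f i
  inflationary = <-weakInduction (λ i → i Fin.≤ f i) z≤n λ i i≤fi →
    ℕ.≤-<-trans (subst (λ k → k ≤ toℕ (f (inject₁ i))) (Fin.toℕ-inject₁ i) i≤fi)
                (strict (inject₁<suc i))

  deflationary : ∀ i → f i Fin.≤ i
  deflationary = >-weakInduction (λ i → f i Fin.≤ i) (Fin.≤fromℕ (f _)) λ i fi≤i →
    subst (λ k → toℕ (f (inject₁ i)) ≤ k) (sym (Fin.toℕ-inject₁ i))
      (ℕ.s≤s⁻¹ (ℕ.<-≤-trans (strict (inject₁<suc i)) fi≤i))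

mono∧injective⇒id : ∀ {n} (f : Fin n → Fin n) →
  (∀ {i j} → i Fin.≤ j → f i Fin.≤ f j) → (∀ {i j} → f i ≡ f j → i ≡ j) →
  ∀ i → f i ≡ i
mono∧injective⇒id f mono injective = strictMono⇒id f λ i<j →
  Fin.≤∧≢⇒< (mono (ℕ.<⇒≤ i<j)) (Fin.<⇒≢ i<j ∘ injective)

module _ {γ : ℕ} where
  open Max (Fin.≤-totalOrder (suc γ))
    using (_⊔_; ⊔-idem; x≤x⊔y; x≤y⇒y⊔x≈y; x⊔y≈x⇒y≤x)
  open WordProperties γ
  open SetOperad (Dias γ)
  open SymmetryProperties (Dias γ) using (∘-isSymmetry)
  open ≡-Reasoning

  -- Partial compositions under reversal.

  comp-++ˡ : ∀ u s i v → i ℕ.< length u →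
             comp (u List.++ s) i v ≡ comp u i v List.++ s
  comp-++ˡ (a ∷ u) s zero    v _         = sym (List.++-assoc (List.map (a ⊔_) v) u s)
  comp-++ˡ (a ∷ u) s (suc i) v (s≤s i<u) = cong (a ∷_) (comp-++ˡ u s i v i<u)

  -- The hypothesis says that position `i` from the left is position `j` from the right. Put
  -- additively, it lets the induction remove the first letter of `u` while `j` stays fixed.
  comp-reverse : ∀ u i j v → suc (i + j) ≡ length u →
    List.reverse (comp u i v) ≡ comp (List.reverse u) j (List.reverse v)
  comp-reverse (a ∷ u) zero j v eq = begin
    List.reverse (List.map (a ⊔_) v List.++ u)
      ≡⟨ List.reverse-++ (List.map (a ⊔_) v) u ⟩
    List.reverse u List.++ List.reverse (List.map (a ⊔_) v)
      ≡⟨ cong (List.reverse u List.++_) (List.reverse-map (a ⊔_) v) ⟨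
    List.reverse u List.++ List.map (a ⊔_) (List.reverse v)
      -- The block is rewritten as a composition into the one-letter word `a`, so that `comp-++` can
      -- shift it past `reverse u`.
      ≡⟨ cong (List.reverse u List.++_) (List.++-identityʳ _) ⟨
    List.reverse u List.++ comp (a ∷ []) 0 (List.reverse v)
      ≡⟨ comp-++ (List.reverse u) (a ∷ []) 0 (List.reverse v) ⟨
    comp (List.reverse u List.∷ʳ a) (length (List.reverse u) + 0) (List.reverse v)
      ≡⟨ cong₂ (λ w k → comp w k (List.reverse v)) (sym (List.unfold-reverse a u)) index ⟩
    comp (List.reverse (a ∷ u)) j (List.reverse v) ∎
    where
    index : length (List.reverse u) + 0 ≡ j
    index = trans (ℕ.+-identityʳ _)
                  (trans (List.length-reverse u) (sym (ℕ.suc-injective eq)))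
  comp-reverse (a ∷ u) (suc i) j v eq = begin
    List.reverse (a ∷ comp u i v)
      ≡⟨ List.unfold-reverse a (comp u i v) ⟩
    List.reverse (comp u i v) List.∷ʳ a
      ≡⟨ cong (List._∷ʳ a) (comp-reverse u i j v (ℕ.suc-injective eq)) ⟩
    comp (List.reverse u) j (List.reverse v) List.∷ʳ a
      ≡⟨ comp-++ˡ (List.reverse u) (a ∷ []) j (List.reverse v) j< ⟨
    comp (List.reverse u List.∷ʳ a) j (List.reverse v)
      ≡⟨ cong (λ w → comp w j (List.reverse v)) (List.unfold-reverse a u) ⟨
    comp (List.reverse (a ∷ u)) j (List.reverse v) ∎
    where
    j< : j ℕ.< length (List.reverse u)
    j< = subst (j ℕ.<_) (trans (ℕ.suc-injective eq) (sym (List.length-reverse u)))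
               (s≤s (ℕ.m≤n+m j i))

  -- The argument passes through lists, where the `cast` in `_⊚⟨_⟩_` disappears.
  reverse-⊚ : ∀ {n m} (u : Word n) (i : Fin (suc n)) (v : Word m) →
              reverse (u ⊚⟨ i ⟩ v) ≡ reverse u ⊚⟨ opposite i ⟩ reverse v
  reverse-⊚ {n} u i v =
    trans (sym (Vec.cast-is-id refl _)) (Vec.toList-injective refl _ _ (begin
      Vec.toList (reverse (u ⊚⟨ i ⟩ v))
        ≡⟨ Vec.toList-reverse (u ⊚⟨ i ⟩ v) ⟩
      List.reverse (Vec.toList (u ⊚⟨ i ⟩ v))
        ≡⟨ cong List.reverse (toList-⊚ u i v) ⟩
      List.reverse (comp (Vec.toList u) (toℕ i) (Vec.toList v))
        ≡⟨ comp-reverse (Vec.toList u) (toℕ i) (toℕ (opposite i)) (Vec.toList v) index ⟩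
      comp (List.reverse (Vec.toList u)) (toℕ (opposite i)) (List.reverse (Vec.toList v))
        ≡⟨ cong₂ (λ x y → comp x (toℕ (opposite i)) y)
                 (Vec.toList-reverse u) (Vec.toList-reverse v) ⟨
      comp (Vec.toList (reverse u)) (toℕ (opposite i)) (Vec.toList (reverse v))
        ≡⟨ toList-⊚ (reverse u) (opposite i) (reverse v) ⟨
      Vec.toList (reverse u ⊚⟨ opposite i ⟩ reverse v) ∎))
    where
    index : suc (toℕ i + toℕ (opposite i)) ≡ length (Vec.toList u)
    index = trans (cong (suc (toℕ i) +_) (Fin.opposite-prop i))
                  (trans (ℕ.m+[n∸m]≡n (Fin.toℕ<n i)) (sym (length-toList u)))

  -- Number of zeros, and the words of arity two.

  zeros : List A → ℕ
  zeros []          = 0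
  zeros (zero  ∷ u) = suc (zeros u)
  zeros (suc _ ∷ u) = zeros u

  zeros-++ : ∀ u v → zeros (u List.++ v) ≡ zeros u + zeros v
  zeros-++ []          v = refl
  zeros-++ (zero  ∷ u) v = cong suc (zeros-++ u v)
  zeros-++ (suc _ ∷ u) v = zeros-++ u v

  zeros-map-suc⊔ : ∀ a v → zeros (List.map (suc a ⊔_) v) ≡ 0
  zeros-map-suc⊔ a []      = refl
  zeros-map-suc⊔ a (b ∷ v) with suc a ⊔ b | x≤x⊔y (suc a) b
  -- The bound `suc a ≤ suc a ⊔ b` rules out a maximum equal to `zero`.
  ... | suc _ | _ = zeros-map-suc⊔ a v

  -- At a letter 0 the word `v` is inserted unchanged, and its only zero replaces the one removed.
  -- At a nonzero letter the maximum leaves no zero in the inserted block.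
  zeros-comp : ∀ u i v → zeros v ≡ 1 → zeros (comp u i v) ≡ zeros u
  zeros-comp []          i       v eq = refl
  zeros-comp (zero  ∷ u) zero    v eq = begin
    zeros (List.map (zero ⊔_) v List.++ u)
      ≡⟨ cong (λ w → zeros (w List.++ u)) (trans (List.map-cong 0⊔ v) (List.map-id v)) ⟩
    zeros (v List.++ u) ≡⟨ zeros-++ v u ⟩
    zeros v + zeros u   ≡⟨ cong (_+ zeros u) eq ⟩
    suc (zeros u)       ∎
  zeros-comp (suc a ∷ u) zero    v eq =
    trans (zeros-++ (List.map (suc a ⊔_) v) u) (cong (_+ zeros u) (zeros-map-suc⊔ a v))
  zeros-comp (zero  ∷ u) (suc i) v eq = cong suc (zeros-comp u i v eq)
  zeros-comp (suc _ ∷ u) (suc i) v eq = zeros-comp u i v eq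

  zeros-generated : ∀ {n} {u : Word n} → Generated (TM γ) (DiasGenerator γ) u →
                    zeros (Vec.toList u) ≡ 1
  zeros-generated (generated (0a a)) = refl
  zeros-generated (generated (a0 a)) = refl
  zeros-generated identity           = refl
  zeros-generated (composition {x = u} {v} p i q) =
    trans (cong zeros (toList-⊚ u i v))
    (trans (zeros-comp (Vec.toList u) (toℕ i) (Vec.toList v) (zeros-generated q))
           (zeros-generated p))

  word-injective : ∀ {n} {x y : Op n} → word x ≡ word y → x ≡ y
  word-injective refl = refl

  0·_ _·0 : Fin γ → Op 1
  0· a = (zero ∷ suc a ∷ []) , [ generated (0a a) ]
  a ·0 = (suc a ∷ zero ∷ []) , [ generated (a0 a) ]

  binary : (x : Op 1) → (∃ λ a → x ≡ 0· a) ⊎ (∃ λ a → x ≡ a ·0)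
  binary ((zero  ∷ suc a ∷ []) , _)     = inj₁ (a , refl)
  binary ((suc a ∷ zero  ∷ []) , _)     = inj₂ (a , refl)
  -- The witness `p` is irrelevant; decidable equality on the naturals turns the false count of
  -- zeros into a usable contradiction.
  binary ((zero  ∷ zero  ∷ []) , [ p ]) =
    contradiction (recompute (2 ℕ.≟ 1) (zeros-generated p)) λ ()
  binary ((suc _ ∷ suc _ ∷ []) , [ p ]) =
    contradiction (recompute (0 ℕ.≟ 1) (zeros-generated p)) λ ()

  -- The mirror image as an antiautomorphism.

  mirror : ∀ {n} → Op n → Op n
  mirror (u , [ p ]) = reverse u , [ reverse-generated p ]
    where
    reverse-generated : ∀ {n} {u : Word n} → Generated (TM γ) (DiasGenerator γ) u →
                        Generated (TM γ) (DiasGenerator γ) (reverse u)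
    reverse-generated (generated (0a a)) = generated (a0 a)
    reverse-generated (generated (a0 a)) = generated (0a a)
    reverse-generated identity           = identity
    reverse-generated (composition {x = u} {v} p i q) =
      subst (Generated (TM γ) (DiasGenerator γ)) (sym (reverse-⊚ u i v))
        (composition (reverse-generated p) (opposite i) (reverse-generated q))

  mirror-involutive : ∀ {n} (x : Op n) → mirror (mirror x) ≡ x
  mirror-involutive x = word-injective (Vec.reverse-involutive (word x))

  mirror-isAntiautomorphism : IsAntiautomorphism (Dias γ) mirror
  mirror-isAntiautomorphism = record
    { isAntimorphism = record
      { ∘-anti-homo = λ x i y → word-injective (reverse-⊚ (word x) i (word y)) }
    ; bijective = λ _ →
        (λ {x} {y} eq → word-injective (Vec.reverse-injective (cong word eq))) ,
        λ y → mirror y , λ { refl → mirror-involutive y }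
    }

  -- Cancellation and order, read off words of arity three.

  -- The second letter of `a ·0` is 0, neutral for the maximum, so the inserted word survives as the
  -- last two letters.
  a·0∘₂-cancelˡ : ∀ a {x y : Op 1} →
    (a ·0) ∘⟨ suc zero ⟩ x ≡ (a ·0) ∘⟨ suc zero ⟩ y → x ≡ y
  a·0∘₂-cancelˡ a {(b ∷ c ∷ []) , _} {(d ∷ e ∷ []) , _} eq =
    word-injective (begin
      b ∷ c ∷ []                   ≡⟨ cong₂ (λ p q → p ∷ q ∷ []) (0⊔ b) (0⊔ c) ⟨
      (zero ⊔ b) ∷ (zero ⊔ c) ∷ [] ≡⟨ cong (Vec.tail ∘ word) eq ⟩
      (zero ⊔ d) ∷ (zero ⊔ e) ∷ [] ≡⟨ cong₂ (λ p q → p ∷ q ∷ []) (0⊔ d) (0⊔ e) ⟩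
      d ∷ e ∷ []                   ∎)

  -- The two composites are the words 0 a max(a,b) and 0 a a, so their equality expresses the order
  -- of the letters in operadic terms.
  ≤⇒0·-absorbs : ∀ {a b} → b Fin.≤ a →
    (0· a) ∘⟨ suc zero ⟩ (0· b) ≡ (0· a) ∘⟨ suc zero ⟩ (0· a)
  ≤⇒0·-absorbs {a} {b} b≤a =
    word-injective (cong (λ c → zero ∷ (suc a ⊔ zero) ∷ c ∷ [])
      (trans (x≤y⇒y⊔x≈y (s≤s b≤a)) (sym (⊔-idem (suc a)))))

  0·-absorbs⇒≤ : ∀ {a b} →
    (0· a) ∘⟨ suc zero ⟩ (0· b) ≡ (0· a) ∘⟨ suc zero ⟩ (0· a) → b Fin.≤ a
  0·-absorbs⇒≤ {a} {b} eq = ℕ.s≤s⁻¹ (x⊔y≈x⇒y≤x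
    (trans (cong (Vec.head ∘ Vec.tail ∘ Vec.tail ∘ word) eq) (⊔-idem (suc a))))

  -- Action of an automorphism on the words 0a.

  module _ {φ : ∀ {n} → Op n → Op n} (auto : IsAutomorphism (Dias γ) φ) where
    open IsAutomorphism auto

    private
      φ-0· : ∀ a → ∃ λ b → φ (0· a) ≡ 0· b
      φ-0· a with binary (φ (0· a))
      ... | inj₁ p        = p
      ... | inj₂ (b , eq) = contradiction
        (proj₁ (bijective 1) (trans eq (a·0∘₂-cancelˡ b φ-collision))) λ ()
        where
        φ-collision : (b ·0) ∘⟨ suc zero ⟩ (b ·0) ≡ (b ·0) ∘⟨ suc zero ⟩ φ (a ·0)
        φ-collision = begin
          (b ·0) ∘⟨ suc zero ⟩ (b ·0)         ≡⟨ cong₂ _∘⟨ suc zero ⟩_ eq eq ⟨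
          φ (0· a) ∘⟨ suc zero ⟩ φ (0· a)     ≡⟨ ∘-homo (0· a) (suc zero) (0· a) ⟨
          -- Both arguments of `φ` are the word 0aa, since max(a,0) = max(a,a) = a.
          φ ((0· a) ∘⟨ suc zero ⟩ (0· a))     ≡⟨ cong φ (word-injective
            (cong₂ (λ c d → zero ∷ c ∷ d ∷ [])
                   (trans (⊔0 (suc a)) (sym (⊔-idem (suc a))))
                   (trans (⊔-idem (suc a)) (sym (⊔0 (suc a)))))) ⟩
          φ ((0· a) ∘⟨ suc zero ⟩ (a ·0))     ≡⟨ ∘-homo (0· a) (suc zero) (a ·0) ⟩
          φ (0· a) ∘⟨ suc zero ⟩ φ (a ·0)     ≡⟨ cong (_∘⟨ suc zero ⟩ φ (a ·0)) eq ⟩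
          (b ·0) ∘⟨ suc zero ⟩ φ (a ·0)       ∎

      π : Fin γ → Fin γ
      π a = proj₁ (φ-0· a)

      φ≡π : ∀ a → φ (0· a) ≡ 0· π a
      φ≡π a = proj₂ (φ-0· a)

      φ-∘₂ : ∀ a b → φ ((0· a) ∘⟨ suc zero ⟩ (0· b)) ≡ (0· π a) ∘⟨ suc zero ⟩ (0· π b)
      φ-∘₂ a b = trans (∘-homo (0· a) (suc zero) (0· b))
                       (cong₂ _∘⟨ suc zero ⟩_ (φ≡π a) (φ≡π b))

      -- The equation expressing `b ≤ a` is carried by `φ` to the one expressing `π b ≤ π a`.
      π-mono : ∀ {b a} → b Fin.≤ a → π b Fin.≤ π a
      π-mono {b} {a} b≤a = 0·-absorbs⇒≤
        (trans (sym (φ-∘₂ a b)) (trans (cong φ (≤⇒0·-absorbs b≤a)) (φ-∘₂ a a)))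

      π-injective : ∀ {a b} → π a ≡ π b → a ≡ b
      π-injective {a} {b} eq
        with refl ← proj₁ (bijective 1) (trans (φ≡π a) (trans (cong 0·_ eq) (sym (φ≡π b))))
        = refl

    automorphism-fixes-0· : ∀ a → φ (0· a) ≡ 0· a
    automorphism-fixes-0· a =
      trans (φ≡π a) (cong 0·_ (mono∧injective⇒id π π-mono π-injective a))

  -- Triviality of automorphisms and the classification.

  module _ {φ : ∀ {n} → Op n → Op n} (auto : IsAutomorphism (Dias γ) φ) where
    open IsAutomorphism auto

    private
      -- The two reversals of order cancel: the composite symmetry evaluates to the automorphism
      -- case, which `from-inj₁` extracts.
      conjugate : IsAutomorphism (Dias γ) (mirror ∘ φ ∘ mirror)
      conjugate = from-inj₁
        (∘-isSymmetry {mirror} {φ ∘ mirror} (inj₂ mirror-isAntiautomorphism)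
          (∘-isSymmetry {φ} {mirror} (inj₁ auto) (inj₂ mirror-isAntiautomorphism)))

      fixes-·0 : ∀ a → φ (a ·0) ≡ a ·0
      fixes-·0 a = trans (sym (mirror-involutive (φ (a ·0))))
                         (cong mirror (automorphism-fixes-0· conjugate a))

      -- The witness of generation is a relevant argument here, so that induction on it is possible.
      fixes-generated : ∀ {n} {u : Word n} (p : Generated (TM γ) (DiasGenerator γ) u) →
                        φ (u , [ p ]) ≡ (u , [ p ])
      fixes-generated (generated (0a a)) = automorphism-fixes-0· auto a
      fixes-generated (generated (a0 a)) = fixes-·0 a
      fixes-generated identity           = unit-homo
      fixes-generated (composition {x = u} {v} p i q) =
        trans (∘-homo (u , [ p ]) i (v , [ q ]))
              (cong₂ _∘⟨ i ⟩_ (fixes-generated p) (fixes-generated q))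

    automorphism-trivial : ∀ {n} (x : Op n) → φ x ≡ x
    automorphism-trivial (u , [ p ]) = word-injective
      -- Only an irrelevant witness is available for an element; decidable equality of words
      -- recovers the equation from it.
      (recompute (Vec.≡-dec Fin._≟_ _ _) (cong word (fixes-generated p)))

  antiautomorphism-mirror : {φ : ∀ {n} → Op n → Op n} → IsAntiautomorphism (Dias γ) φ →
                            ∀ {n} (x : Op n) → φ x ≡ mirror x
  antiautomorphism-mirror {φ} anti x = begin
    φ x                   ≡⟨ cong φ (mirror-involutive x) ⟨
    φ (mirror (mirror x)) ≡⟨ automorphism-trivial composite (mirror x) ⟩
    mirror x              ∎
    where
    composite : IsAutomorphism (Dias γ) (φ ∘ mirror)
    composite = from-inj₁
      (∘-isSymmetry {φ} {mirror} (inj₂ anti) (inj₂ mirror-isAntiautomorphism))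

-- For `γ = 0` the only word is 0, and the mirror image coincides with the identity; the two
-- symmetries are distinct from `γ = 1` on.
proposition2p3p2 : (γ : ℕ) →
    let open Group (symmetryGroup (Dias γ)) in
    Σ[ μ ∈ Carrier ]
    (∀ {n} (x : SetOperad.Op (Dias γ) n) → word (Symmetry.map μ x) ≡ reverse (word x))
    × (∀ (σ : Carrier) → σ ≈ ε ⊎ σ ≈ μ)
    × (1 ≤ γ → ¬ (μ ≈ ε))
proposition2p3p2 γ =
  symmetry mirror (inj₂ mirror-isAntiautomorphism) ,
  (λ _ → refl) ,
  (λ { (symmetry _ (inj₁ auto)) → inj₁ (automorphism-trivial auto)
     ; (symmetry _ (inj₂ anti)) → inj₂ (antiautomorphism-mirror anti) }) ,
  -- The word 01 is sent to 10, which differs from it in the first letter.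
  λ { (s≤s z≤n) μ≈ε → contradiction (μ≈ε (0· zero)) λ () }
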